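{- Let $\Sigma^\nabla$ be an intersection-type theory and let $\models^\nabla$ be any one of the three semantic satisfiability relations $\models^\nabla_i$ (inference semantics), $\models^\nabla_s$ (simple semantics), $\models^\nabla_F$ (F-semantics). If $\Gamma\models^\nabla M:A$ implies $\Gamma\vdash^\nabla M:A$ for all $\nabla$-bases $\Gamma$, $\lambda$-terms $M$ and types $A\in\mathsf{T}^\nabla$, then $\Sigma^\nabla$ is a natural or a strict type theory.
   Context: **Types and theories.** Given a set $\mathsf{C}$ of type constants, $\mathsf{T}(\mathsf{C})$ is generated by $\mathsf{T}=\mathsf{C}\mid \mathsf{T}\to\mathsf{T}\mid\mathsf{T}\cap\mathsf{T}$. Let $\nabla^0$ consist of the axioms $A\le A$; $A\le A\cap A$; $A\cap B\le A$; $A\cap B\le B$; and the rules: $A\le A'$, $B\le B'$ imply $A\cap B\le A'\cap B'$; $A\le B$, $B\le C$ imply $A\le C$. Given a collection $\nabla$ of further axioms and rules for judgments $A\le B$ over $\mathsf{T}(\mathsf{C})$, the intersection-type theory $\Sigma^\nabla=\Sigma(\mathsf{C},\nabla)$ is the set of judgments $A\le B$ derivable from $\nabla^0\cup\nabla$. Write $\mathsf{C}^\nabla=\mathsf{C}$, $\mathsf{T}^\nabla=\mathsf{T}(\mathsf{C})$, $A\le_\nabla B$ for $(A\le B)\in\Sigma^\nabla$, and $A\sim_\nabla B$ for $A\le_\nabla B\le_\nabla A$. $\Sigma^\nabla$ *validates* a collection of axioms and rules if all of them are admissible in $\Sigma^\nabla$. There are two special constants $\Omega,\nu$. Standing assumptions: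 $\Omega$ and $\nu$ are not both in $\mathsf{C}^\nabla$; if $\Omega\in\mathsf{C}^\nabla$ then $\nabla$ contains the axiom $(\Omega)$: $A\le\Omega$; if $\nu\in\mathsf{C}^\nabla$ then $\nabla$ contains the axiom $(\nu)$: $A\to B\le\nu$. Axioms and rules: ($\to$-$\cap$): $(A\to B)\cap(A\to C)\le A\to B\cap C$ (here $\cap$ binds tighter than $\to$); ($\eta$): $A'\le A$ and $B\le B'$ imply $A\to B\le A'\to B'$; ($\Omega$-lazy): $A\to B\le\Omega\to\Omega$. $\Sigma^\nabla$ is *strict* if $\Omega\notin\mathsf{C}^\nabla$ and it validates ($\to$-$\cap$) and ($\eta$). $\Sigma^\nabla$ is *natural* if $\Omega\in\mathsf{C}^\nabla$ and it validates ($\to$-$\cap$), ($\eta$), ($\Omega$) and ($\Omega$-lazy). **Type assignment.** A $\nabla$-basis $\Gamma$ is a set of statements $x:B$ with $x$ a term variable and $B\in\mathsf{T}^\nabla$, all of whose variables are distinct. Judgments $\Gamma\vdash^\nabla M:A$ ($M$ an untyped $\lambda$-term, $A\in\mathsf{T}^\nabla$) are derived by: (Ax) $\Gamma\vdash^\nabla x:A$ if $(x:A)\in\Gamma$; ($\to$I) from $\Gamma,x:A\vdash^\nabla M:B$ infer $\Gamma\vdash^\nabla\lambda x.M:A\to B$; ($\to$E) from $\Gamma\vdash^\nabla M:A\to B$ and $\Gamma\vdash^\nabla N:A$ infer $\Gamma\vdash^\nabla MN:B$; ($\cap$I) from $\Gamma\vdash^\nabla M:A$ and $\Gamma\vdash^\nabla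 M:B$ infer $\Gamma\vdash^\nabla M:A\cap B$; ($\le_\nabla$) from $\Gamma\vdash^\nabla M:A$ and $A\le_\nabla B$ infer $\Gamma\vdash^\nabla M:B$; moreover, if $\Omega\in\mathsf{C}^\nabla$, (Ax-$\Omega$) $\Gamma\vdash^\nabla M:\Omega$ for every $M$; if $\nu\in\mathsf{C}^\nabla$, (Ax-$\nu$) $\Gamma\vdash^\nabla\lambda x.M:\nu$ for every $x,M$. **Semantics.** Let $\Lambda$ be the set of $\lambda$-terms and $\mathrm{Var}$ the set of term variables. A *$\lambda$-applicative structure* is a triple $\langle\mathcal D,\cdot,[\![\;]\!]^{\mathcal D}\rangle$ where $\langle\mathcal D,\cdot\rangle$ is an applicative structure (a set with a binary operation) and $[\![\;]\!]^{\mathcal D}:\Lambda\times(\mathrm{Var}\to\mathcal D)\to\mathcal D$, $(M,\rho)\mapsto[\![M]\!]^{\mathcal D}_\rho$, is an interpretation function for $\lambda$-terms. A *type interpretation domain* is $\mathcal I=\langle\mathcal D,\cdot,[\![\;]\!]^{\mathcal D},\Phi\rangle$ where $\langle\mathcal D,\cdot,[\![\;]\!]^{\mathcal D}\rangle$ is a $\lambda$-applicative structure and $\Phi\subseteq\mathcal D$ satisfies $[\![\lambda x.M]\!]^{\mathcal D}_\rho\in\Phi$ for all $x,M,\rho$. It is a *simple interpretation domain* if $\Phi=\mathcal D$, and an *F-interpretation domain* if $\Phi=\{d\in\mathcal D\mid d=[\![\lambda x.M]\!]^{\mathcal D}_\rho\text{ for some }x,M,\rho\}$. Given a type environment $\mathcal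 V:\mathsf{C}^\nabla\to\mathsf P(\mathcal D)$ ($\mathsf P$ = powerset), put $[\![\Omega]\!]^{\mathcal I}_{\mathcal V}=\mathcal D$; $[\![\nu]\!]^{\mathcal I}_{\mathcal V}=\Phi$; $[\![\psi]\!]^{\mathcal I}_{\mathcal V}=\mathcal V(\psi)$ for other constants $\psi$; $[\![A\to B]\!]^{\mathcal I}_{\mathcal V}=\{X\in\Phi\mid\forall Y\in[\![A]\!]^{\mathcal I}_{\mathcal V}.\ X\cdot Y\in[\![B]\!]^{\mathcal I}_{\mathcal V}\}$; $[\![A\cap B]\!]^{\mathcal I}_{\mathcal V}=[\![A]\!]^{\mathcal I}_{\mathcal V}\cap[\![B]\!]^{\mathcal I}_{\mathcal V}$. A term environment $\rho:\mathrm{Var}\to\mathcal D$ is *good* if $[\![x]\!]^{\mathcal D}_\rho=\rho(x)$ for all $x\in\mathrm{Var}$ and there are terms $M,N$ with $[\![M]\!]^{\mathcal D}_\rho\ne[\![N]\!]^{\mathcal D}_\rho$. The pair $\mathcal I,\mathcal V$ is *$\nabla$-good* if for all $A,B\in\mathsf{T}^\nabla$: (a) for all good $\rho$, all variables $x$ and all $d\in[\![A]\!]^{\mathcal I}_{\mathcal V}$, $\rho[x:=d]$ is good; (b) for all good $\rho$, terms $M$, variables $x$: if $[\![M]\!]^{\mathcal D}_{\rho[x:=d]}\in[\![B]\!]^{\mathcal I}_{\mathcal V}$ for all $d\in[\![A]\!]^{\mathcal I}_{\mathcal V}$, then $[\![\lambda x.M]\!]^{\mathcal D}_\rho\in[\![A\to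 B]\!]^{\mathcal I}_{\mathcal V}$. It is *$\nabla$-F-good* if it is $\nabla$-good and moreover for all good $\rho$, variables $x$ and $A\in\mathsf{T}^\nabla$: $[\![x]\!]^{\mathcal D}_\rho\in[\![A]\!]^{\mathcal I}_{\mathcal V}\cap\Phi$ implies $[\![\lambda y.xy]\!]^{\mathcal D}_\rho\in[\![A]\!]^{\mathcal I}_{\mathcal V}$. The pair *agrees* with $\Sigma^\nabla$ if $A\le_\nabla B$ implies $[\![A]\!]^{\mathcal I}_{\mathcal V}\subseteq[\![B]\!]^{\mathcal I}_{\mathcal V}$ for all $A,B\in\mathsf{T}^\nabla$. Write $\mathcal I,\rho,\mathcal V\models M:A$ iff $[\![M]\!]^{\mathcal D}_\rho\in[\![A]\!]^{\mathcal I}_{\mathcal V}$, and $\mathcal I,\rho,\mathcal V\models\Gamma$ iff $\mathcal I,\rho,\mathcal V\models x:B$ for all $(x:B)\in\Gamma$. Then $\Gamma\models^\nabla_i M:A$ (resp. $\Gamma\models^\nabla_s M:A$, $\Gamma\models^\nabla_F M:A$) iff, for all good term environments $\rho$ and all pairs $\mathcal I,\mathcal V$ which agree with $\Sigma^\nabla$ and are such that $\mathcal I$ is a type interpretation domain and $\mathcal I,\mathcal V$ is $\nabla$-good (resp. $\mathcal I$ is a simple interpretation domain and $\mathcal I,\mathcal V$ is $\nabla$-good; $\mathcal I$ is an F-interpretation domain and $\mathcal I,\mathcal V$ is $\nabla$-F-good), $\mathcal I,\rho,\mathcal V\models\Gamma$ implies $\mathcal I,\rho,\mathcal V\models M:A$.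 -}

module Defs where

open import Level using (Level; _⊔_) renaming (suc to lsuc)
open import Data.Bool.Base using (Bool; T)
open import Data.Fin.Base using (Fin; fromℕ; inject₁)
open import Data.List.Base using (List; []; _∷_)
open import Data.List.Relation.Unary.All using (All)
open import Data.Nat.Base using (ℕ; suc)
open import Data.Nat.Properties using (_≟_)
open import Data.Product.Base using (Σ-syntax; ∃-syntax; _×_; _,_)
open import Data.Sum.Base using (_⊎_; inj₁; inj₂)
open import Data.Unit.Polymorphic.Base using (⊤)
open import Function.Base using (const)
open import Relation.Binary.PropositionalEquality using (_≡_; _≢_; sym; trans)
open import Relation.Nullary using (¬_; yes; no; contradiction)
open import Relation.Unary using (Pred; _∈_; _⊆_; _≐_; _∪_) renaming (_∩_ to _∩ᵖ_)

private
  variable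
    c ℓ d : Level
    n : ℕ

------------------------------------------------------------------------
-- λ-terms

Var : Set
Var = ℕ

-- Locally nameless syntax, so that α-equivalence is propositional equality.
-- Free variables are names; Fin n indexes the n enclosing binders, innermost first.

infixl 9 _·_

data Term (n : ℕ) : Set where
  var   : Var → Term n
  bound : Fin n → Term n
  _·_   : Term n → Term n → Term n
  lam   : Term (suc n) → Term n

Λ : Set
Λ = Term 0

-- Replaces the name x by a reference to a new outermost binder.

close : Var → Term n → Term (suc n)
close {n} x (var y) with y ≟ x
... | yes _ = bound (fromℕ n)
... | no  _ = var y
close x (bound i) = bound (inject₁ i)
close x (M · N)   = close x M · close x N
close x (lam M)   = lam (close x M)

-- ƛ x M is the class of the named term λx.M.

ƛ : Var → Λ → Λ
ƛ x M = lam (close x M)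

------------------------------------------------------------------------
-- Intersection types

-- A set of type constants. Membership of the two special constants is
-- two-valued; the remaining constants form an arbitrary set.

record Constants c : Set (lsuc c) where
  field
    hasΩ hasν : Bool
    Ordinary  : Set c

  Ω∈C : Set
  Ω∈C = T hasΩ

  ν∈C : Set
  ν∈C = T hasν

module _ (C : Constants c) where
  open Constants C

  data Constant : Set c where
    Ωᶜ  : Ω∈C → Constant
    νᶜ  : ν∈C → Constant
    ord : Ordinary → Constant

  infixr 6 _⇒_
  infixr 7 _∩_

  data Type : Set c where
    con : Constant → Type
    _⇒_ : Type → Type → Type
    _∩_ : Type → Type → Type

  infix 4 _≼_
  infix 3 _⟹_

  record Judgement : Set c where
    constructor _≼_
    field
      lhs rhs : Type

  -- One instance of a rule; an instance of an axiom has no premises.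
  -- An axiom, a rule, or a collection of them is the set of its instances.

  record RuleInstance : Set c where
    constructor _⟹_
    field
      premises   : List Judgement
      conclusion : Judgement

  data Ω-axiom (p : Ω∈C) : Pred RuleInstance c where
    inst : ∀ A → Ω-axiom p ([] ⟹ A ≼ con (Ωᶜ p))

  data ν-axiom (p : ν∈C) : Pred RuleInstance c where
    inst : ∀ A B → ν-axiom p ([] ⟹ A ⇒ B ≼ con (νᶜ p))

  data →∩-axiom : Pred RuleInstance c where
    inst : ∀ A B D → →∩-axiom ([] ⟹ (A ⇒ B) ∩ (A ⇒ D) ≼ A ⇒ (B ∩ D))

  data η-rule : Pred RuleInstance c where
    inst : ∀ A A′ B B′ →
           η-rule ((A′ ≼ A) ∷ (B ≼ B′) ∷ [] ⟹ A ⇒ B ≼ A′ ⇒ B′)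

  data Ω-lazy-axiom (p : Ω∈C) : Pred RuleInstance c where
    inst : ∀ A B →
           Ω-lazy-axiom p ([] ⟹ A ⇒ B ≼ con (Ωᶜ p) ⇒ con (Ωᶜ p))

record IntersectionTypeTheory c ℓ : Set (lsuc (c ⊔ ℓ)) where
  field
    constants : Constants c
  open Constants constants public
  field
    ∇       : Pred (RuleInstance constants) ℓ
    notBoth : ¬ (Ω∈C × ν∈C)
    Ω-in-∇  : (p : Ω∈C) → Ω-axiom constants p ⊆ ∇
    ν-in-∇  : (p : ν∈C) → ν-axiom constants p ⊆ ∇

module _ (𝒯 : IntersectionTypeTheory c ℓ) where
  open IntersectionTypeTheory 𝒯

  Ty : Set c
  Ty = Type constants

  data Derivable : Pred (Judgement constants) (c ⊔ ℓ) where
    ≤-refl  : ∀ {A} → Derivable (A ≼ A)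
    ≤-idem  : ∀ {A} → Derivable (A ≼ A ∩ A)
    ≤-∩ˡ    : ∀ {A B} → Derivable (A ∩ B ≼ A)
    ≤-∩ʳ    : ∀ {A B} → Derivable (A ∩ B ≼ B)
    ≤-mono  : ∀ {A A′ B B′} → Derivable (A ≼ A′) → Derivable (B ≼ B′) →
              Derivable (A ∩ B ≼ A′ ∩ B′)
    ≤-trans : ∀ {A B D} → Derivable (A ≼ B) → Derivable (B ≼ D) →
              Derivable (A ≼ D)
    ≤-rule  : ∀ {ps j} → (ps ⟹ j) ∈ ∇ → All Derivable ps → Derivable j

  Admissible : Pred (RuleInstance constants) (c ⊔ ℓ)
  Admissible (ps ⟹ j) = All Derivable ps → Derivable j

  Validates : Pred (RuleInstance constants) c → Set (c ⊔ ℓ)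
  Validates R = R ⊆ Admissible

  Strict : Set (c ⊔ ℓ)
  Strict = ¬ Ω∈C × Validates (→∩-axiom constants ∪ η-rule constants)

  Natural : Set (c ⊔ ℓ)
  Natural = Σ[ p ∈ Ω∈C ]
    Validates (→∩-axiom constants ∪ η-rule constants ∪
               Ω-axiom constants p ∪ Ω-lazy-axiom constants p)

  ----------------------------------------------------------------------
  -- Type assignment

  record Basis : Set (lsuc c) where
    field
      Declares : Var → Ty → Set c
      distinct : ∀ {x A B} → Declares x A → Declares x B → A ≡ B
  open Basis

  infixl 5 _,_∶_

  -- Γ , x ∶ A discards any declaration of x in Γ. Since terms are taken up to
  -- α-conversion, for finite Γ this derives the same judgements as requiring
  -- x ∉ Γ; it also makes sense of abstraction when Γ declares every variable.

  _,_∶_ : Basis → Var → Ty → Basis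
  (Γ , x ∶ A) .Declares y B = (y ≢ x × Declares Γ y B) ⊎ (y ≡ x × B ≡ A)
  (Γ , x ∶ A) .distinct (inj₁ (_ , p))   (inj₁ (_ , q))   = distinct Γ p q
  (Γ , x ∶ A) .distinct (inj₁ (y≢x , _)) (inj₂ (y≡x , _)) = contradiction y≡x y≢x
  (Γ , x ∶ A) .distinct (inj₂ (y≡x , _)) (inj₁ (y≢x , _)) = contradiction y≡x y≢x
  (Γ , x ∶ A) .distinct (inj₂ (_ , p))   (inj₂ (_ , q))   = trans p (sym q)

  infix 3 _⊢_∶_

  data _⊢_∶_ (Γ : Basis) : Λ → Ty → Set (c ⊔ ℓ) where
    Ax   : ∀ {x A} → Declares Γ x A → Γ ⊢ var x ∶ A
    →I   : ∀ {x M A B} → (Γ , x ∶ A) ⊢ M ∶ B → Γ ⊢ ƛ x M ∶ A ⇒ B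
    →E   : ∀ {M N A B} → Γ ⊢ M ∶ A ⇒ B → Γ ⊢ N ∶ A → Γ ⊢ M · N ∶ B
    ∩I   : ∀ {M A B} → Γ ⊢ M ∶ A → Γ ⊢ M ∶ B → Γ ⊢ M ∶ A ∩ B
    ≤I   : ∀ {M A B} → Γ ⊢ M ∶ A → Derivable (A ≼ B) → Γ ⊢ M ∶ B
    Ax-Ω : ∀ {M} (p : Ω∈C) → Γ ⊢ M ∶ con (Ωᶜ p)
    Ax-ν : ∀ {x M} (p : ν∈C) → Γ ⊢ ƛ x M ∶ con (νᶜ p)

------------------------------------------------------------------------
-- Semantics

record λ-ApplicativeStructure d : Set (lsuc d) where
  infixl 9 _∙_
  field
    Carrier : Set d
    _∙_     : Carrier → Carrier → Carrier
    ⟦_⟧     : Λ → (Var → Carrier) → Carrier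

  Env : Set d
  Env = Var → Carrier

  _[_≔_] : Env → Var → Carrier → Env
  (ρ [ x ≔ a ]) y with y ≟ x
  ... | yes _ = a
  ... | no  _ = ρ y

  Good : Pred Env d
  Good ρ = (∀ x → ⟦ var x ⟧ ρ ≡ ρ x) × ∃[ M ] ∃[ N ] ⟦ M ⟧ ρ ≢ ⟦ N ⟧ ρ

record TypeInterpretationDomain d : Set (lsuc d) where
  field
    structure : λ-ApplicativeStructure d
  open λ-ApplicativeStructure structure public
  field
    Φ   : Pred Carrier d
    ƛ∈Φ : ∀ x M ρ → ⟦ ƛ x M ⟧ ρ ∈ Φ

  IsSimple : Set d
  IsSimple = ∀ a → a ∈ Φ

  IsF : Set d
  IsF = Φ ≐ λ a → ∃[ x ] ∃[ M ] ∃[ ρ ] a ≡ ⟦ ƛ x M ⟧ ρ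

data Semantics : Set where
  inference simple F : Semantics

module _ (𝒯 : IntersectionTypeTheory c ℓ) where
  open IntersectionTypeTheory 𝒯

  TypeEnv : TypeInterpretationDomain d → Set (c ⊔ lsuc d)
  TypeEnv {d} ℐ = Constant constants → Pred (TypeInterpretationDomain.Carrier ℐ) d

  module Interpretation (ℐ : TypeInterpretationDomain d) (𝒱 : TypeEnv ℐ) where
    open TypeInterpretationDomain ℐ

    ⟦_⟧ᵗ : Ty 𝒯 → Pred Carrier d
    ⟦ con (Ωᶜ _) ⟧ᵗ    = const ⊤
    ⟦ con (νᶜ _) ⟧ᵗ    = Φ
    ⟦ con (ord ψ) ⟧ᵗ   = 𝒱 (ord ψ)
    ⟦ A ⇒ B ⟧ᵗ         = λ X → X ∈ Φ × (∀ Y → Y ∈ ⟦ A ⟧ᵗ → X ∙ Y ∈ ⟦ B ⟧ᵗ)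
    ⟦ A ∩ B ⟧ᵗ         = ⟦ A ⟧ᵗ ∩ᵖ ⟦ B ⟧ᵗ

    record ∇-Good : Set (c ⊔ d) where
      field
        update : ∀ (A : Ty 𝒯) {ρ} → Good ρ → ∀ x {a} → a ∈ ⟦ A ⟧ᵗ →
                 Good (ρ [ x ≔ a ])
        abs    : ∀ (A B : Ty 𝒯) {ρ} → Good ρ → ∀ M x →
                 (∀ a → a ∈ ⟦ A ⟧ᵗ → ⟦ M ⟧ (ρ [ x ≔ a ]) ∈ ⟦ B ⟧ᵗ) →
                 ⟦ ƛ x M ⟧ ρ ∈ ⟦ A ⇒ B ⟧ᵗ

    record ∇-F-Good : Set (c ⊔ d) where
      field
        ∇-good : ∇-Good
        expand : ∀ (A : Ty 𝒯) {ρ} → Good ρ → ∀ x y → y ≢ x →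
                 ⟦ var x ⟧ ρ ∈ ⟦ A ⟧ᵗ ∩ᵖ Φ →
                 ⟦ ƛ y (var x · var y) ⟧ ρ ∈ ⟦ A ⟧ᵗ

    Agrees : Set (c ⊔ ℓ ⊔ d)
    Agrees = ∀ {A B : Ty 𝒯} → Derivable 𝒯 (A ≼ B) → ⟦ A ⟧ᵗ ⊆ ⟦ B ⟧ᵗ

    Suitable : Semantics → Set (c ⊔ d)
    Suitable inference = ∇-Good
    Suitable simple    = IsSimple × ∇-Good
    Suitable F         = IsF × ∇-F-Good

    Satisfies : Env → Λ → Ty 𝒯 → Set d
    Satisfies ρ M A = ⟦ M ⟧ ρ ∈ ⟦ A ⟧ᵗ

    SatisfiesBasis : Env → Basis 𝒯 → Set (c ⊔ d)
    SatisfiesBasis ρ Γ = ∀ {x B} → Basis.Declares Γ x B → Satisfies ρ (var x) B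

  -- Carriers range over Set d and the subsets of a carrier over its
  -- Set d-valued predicates.

  SemanticallyEntails : (d : Level) → Semantics → Basis 𝒯 → Λ → Ty 𝒯 →
                        Set (c ⊔ ℓ ⊔ lsuc d)
  SemanticallyEntails d s Γ M A =
    (ℐ : TypeInterpretationDomain d) (𝒱 : TypeEnv ℐ) →
    let open TypeInterpretationDomain ℐ
        open Interpretation ℐ 𝒱
    in (ρ : Env) → Good ρ → Agrees → Suitable s →
       SatisfiesBasis ρ Γ → Satisfies ρ M A

{-# OPTIONS --safe #-}

-- By generation for variables, x : A ⊢ x : B holds only if A ≤ B. So completeness at
-- x : A ⊨ x : B turns every inclusion ⟦ A ⟧ ⊆ ⟦ B ⟧ that holds in all interpretations
-- agreeing with the theory into a derivable inequality, whichever semantics is meant.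

module Submission where

open import Defs
open import Level using (Level; _⊔_) renaming (suc to lsuc)
open import Data.Bool.Properties using (T?)
open import Data.List.Base using ([])
open import Data.List.Relation.Unary.All using ([]; _∷_)
open import Data.Product.Base using (_×_; _,_; proj₁; proj₂)
open import Data.Sum.Base using (_⊎_; inj₁; inj₂)
open import Data.Unit.Polymorphic.Base using (tt)
open import Relation.Binary.PropositionalEquality using (_≡_; refl; sym; trans)
open import Relation.Nullary using (yes; no)
open import Relation.Unary using (_⊆_; _∪_)

module _ {c ℓ} (𝒯 : IntersectionTypeTheory c ℓ) where
  open IntersectionTypeTheory 𝒯
  open Basis

  Ω-maximum : ∀ p {A} → Derivable 𝒯 (A ≼ con (Ωᶜ p))
  Ω-maximum p {A} = ≤-rule (Ω-in-∇ p (inst A)) []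

  -- Induction on the derivation: `→I`, `→E` and `Ax-ν` type abstractions or applications, never a
  -- variable, and each remaining rule is matched by a step of the preorder.
  ⊢-var⁻ : ∀ {Γ x A B} → Declares Γ x A → _⊢_∶_ 𝒯 Γ (var x) B → Derivable 𝒯 (A ≼ B)
  ⊢-var⁻ {Γ} x∶A (Ax x∶B) with distinct Γ x∶A x∶B
  ... | refl = ≤-refl
  ⊢-var⁻ x∶A (∩I ⊢B ⊢D)  = ≤-trans ≤-idem (≤-mono (⊢-var⁻ x∶A ⊢B) (⊢-var⁻ x∶A ⊢D))
  ⊢-var⁻ x∶A (≤I ⊢B B≤D) = ≤-trans (⊢-var⁻ x∶A ⊢B) B≤D
  ⊢-var⁻ x∶A (Ax-Ω p)    = Ω-maximum p

  singleton : Var → Ty 𝒯 → Basis 𝒯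
  singleton x A .Declares y B                  = y ≡ x × B ≡ A
  singleton x A .distinct (_ , B≡A) (_ , D≡A) = trans B≡A (sym D≡A)

  Complete : (d : Level) → Semantics → Set (lsuc c ⊔ ℓ ⊔ lsuc d)
  Complete d s = ∀ Γ M A → SemanticallyEntails 𝒯 d s Γ M A → _⊢_∶_ 𝒯 Γ M A

  _≤ˢ[_]_ : Ty 𝒯 → (d : Level) → Ty 𝒯 → Set (c ⊔ ℓ ⊔ lsuc d)
  A ≤ˢ[ d ] B = (ℐ : TypeInterpretationDomain d) (𝒱 : TypeEnv 𝒯 ℐ) →
    let open Interpretation 𝒯 ℐ 𝒱 in Agrees → ⟦ A ⟧ᵗ ⊆ ⟦ B ⟧ᵗ

  module _ {d s} (complete : Complete d s) where

    ≤ˢ⇒≤ : ∀ {A B} → A ≤ˢ[ d ] B → Derivable 𝒯 (A ≼ B)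
    ≤ˢ⇒≤ {A} {B} A≤ˢB =
      ⊢-var⁻ {Γ = singleton 0 A} (refl , refl)
        (complete (singleton 0 A) (var 0) B
          λ ℐ 𝒱 ρ _ agrees _ ρ⊨Γ → A≤ˢB ℐ 𝒱 agrees (ρ⊨Γ (refl , refl)))

    validates-→∩-η : Validates 𝒯 (→∩-axiom constants ∪ η-rule constants)
    validates-→∩-η (inj₁ (inst A B D)) [] = ≤ˢ⇒≤
      λ ℐ 𝒱 _ ((X∈Φ , X∈A⇒B) , (_ , X∈A⇒D)) →
        X∈Φ , λ Y Y∈A → X∈A⇒B Y Y∈A , X∈A⇒D Y Y∈A
    -- The premises are derivable, so agreement turns them into inclusions between interpretations.
    validates-→∩-η (inj₂ (inst A A′ B B′)) (A′≤A ∷ B≤B′ ∷ []) = ≤ˢ⇒≤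
      λ ℐ 𝒱 agrees (X∈Φ , X∈A⇒B) →
        X∈Φ , λ Y Y∈A′ → agrees B≤B′ (X∈A⇒B Y (agrees A′≤A Y∈A′))

    -- Since Ω denotes the whole carrier, Ω → Ω denotes `Φ`, which contains every arrow type.
    validates-Ω-lazy : ∀ p → Validates 𝒯 (Ω-lazy-axiom constants p)
    validates-Ω-lazy p (inst A B) [] = ≤ˢ⇒≤ λ ℐ 𝒱 _ (X∈Φ , _) → X∈Φ , λ _ _ → tt

    natural : Ω∈C → Natural 𝒯
    natural p .proj₁ = p
    natural p .proj₂ (inj₁ →∩) = validates-→∩-η (inj₁ →∩)
    natural p .proj₂ (inj₂ (inj₁ η)) = validates-→∩-η (inj₂ η)
    natural p .proj₂ (inj₂ (inj₂ (inj₁ (inst A)))) [] = Ω-maximum p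
    natural p .proj₂ (inj₂ (inj₂ (inj₂ Ω-lazy))) = validates-Ω-lazy p Ω-lazy

proposition5p11 : ∀ {c ℓ} (d : Level) (𝒯 : IntersectionTypeTheory c ℓ) (s : Semantics) →
    (∀ (Γ : Basis 𝒯) (M : Λ) (A : Ty 𝒯) →
    SemanticallyEntails 𝒯 d s Γ M A → _⊢_∶_ 𝒯 Γ M A) →
    Natural 𝒯 ⊎ Strict 𝒯
-- Membership of Ω is Boolean, so this case split is constructive.
proposition5p11 d 𝒯 s complete with T? (IntersectionTypeTheory.hasΩ 𝒯)
... | yes Ω∈C = inj₁ (natural 𝒯 complete Ω∈C)
... | no  Ω∉C = inj₂ (Ω∉C , validates-→∩-η 𝒯 complete)
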